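{- Let $D$ be a semicomplete digraph. Then $$\chi'_{\mathrm{wo}}(D) = \begin{cases} 0 & \text{if } D = K_1,\\ 1 & \text{if } D \text{ is nontrivial and every semi-degree } d_D^+(v), d_D^-(v) \ (v\in V(D)) \text{ is odd or zero},\\ 3 & \text{if } D \text{ is a nontrivial even digraph with exactly one peripheral vertex},\\ 2 & \text{otherwise.}\end{cases}$$
   Context: All digraphs are finite, without loops or parallel arcs (a pair of opposite arcs $uv, vu$ is allowed). A digraph $D$ is semicomplete if every pair of distinct vertices is joined by at least one arc (in one or both directions). For a vertex $v$, the semi-cuts of $v$ are $\partial_D^+(v)=\{vw\in A(D)\}$ and $\partial_D^-(v)=\{uv\in A(D)\}$; the semi-degrees are $d_D^+(v)=|\partial_D^+(v)|$ and $d_D^-(v)=|\partial_D^-(v)|$, and $d_D(v)=d_D^+(v)+d_D^-(v)$. A map $\varphi:A(D)\to[k]=\{1,\dots,k\}$ satisfies condition (WO) at $v$ if there is a color $i\in[k]$ such that every nonempty semi-cut of $v$ contains an odd number of arcs of color $i$ (vacuously true if both semi-cuts are empty). $\varphi$ is a weak-odd $k$-edge coloring if (WO) holds at every vertex. The weak-odd chromatic index $\chi'_{\mathrm{wo}}(D)$ is the least integer $k\ge 0$ such that $D$ has a weak-odd $k$-edge coloring. A vertex $v$ is peripheral if $d_D^+(v)=0$ or $d_D^-(v)=0$. $D$ is even if $d_D(v)$ is even for every vertex $v$. $D$ is nontrivial if it has more than one vertex. -}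

module Defs where

open import Data.Nat using (ℕ; zero; suc; _+_; _%_)
open import Data.Bool using (Bool; true; false; T; _∧_; _∨_; not)
open import Data.Unit using (tt)
open import Data.Fin using (Fin; _≟_) renaming (zero to fzero; suc to fsuc)
open import Data.Product using (Σ; ∃; _×_; _,_)
open import Data.Sum using (_⊎_)
open import Relation.Nullary using (¬_; ⌊_⌋)
open import Relation.Binary.PropositionalEquality using (_≡_; _≢_)

record Digraph (n : ℕ) : Set where
  field
    arc      : Fin n → Fin n → Bool
    loopless : ∀ v → arc v v ≡ false
open Digraph public

Semicomplete : ∀ {n} → Digraph n → Set
Semicomplete {n} D = ∀ (u v : Fin n) → u ≢ v → T (arc D u v ∨ arc D v u)

count : ∀ n → (Fin n → Bool) → ℕ
count zero    p = 0
count (suc n) p = b2n (p fzero) + count n (λ x → p (fsuc x))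
  where
  b2n : Bool → ℕ
  b2n true  = 1
  b2n false = 0

Odd : ℕ → Set
Odd m = m % 2 ≡ 1

Even : ℕ → Set
Even m = m % 2 ≡ 0

outdeg : ∀ {n} → Digraph n → Fin n → ℕ
outdeg {n} D v = count n (λ w → arc D v w)

indeg : ∀ {n} → Digraph n → Fin n → ℕ
indeg {n} D v = count n (λ u → arc D u v)

deg : ∀ {n} → Digraph n → Fin n → ℕ
deg D v = outdeg D v + indeg D v

ArcColoring : ∀ {n} → Digraph n → ℕ → Set
ArcColoring {n} D k = (u v : Fin n) → T (arc D u v) → Fin k

-- is the (possible) arc with witness type T b colored i?
colIs : ∀ {k} (b : Bool) → (T b → Fin k) → Fin k → Bool
colIs true  f i = ⌊ f tt ≟ i ⌋
colIs false f i = false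

outcol : ∀ {n k} (D : Digraph n) → ArcColoring D k → Fin k → Fin n → ℕ
outcol {n} D φ i v = count n (λ w → colIs (arc D v w) (φ v w) i)

incol : ∀ {n k} (D : Digraph n) → ArcColoring D k → Fin k → Fin n → ℕ
incol {n} D φ i u = count n (λ w → colIs (arc D w u) (φ w u) i)

WO : ∀ {n k} (D : Digraph n) → ArcColoring D k → Fin n → Set
WO {n} {k} D φ v =
  (outdeg D v ≡ 0 × indeg D v ≡ 0)
  ⊎ Σ (Fin k) (λ i → (outdeg D v ≢ 0 → Odd (outcol D φ i v))
                    × (indeg D v ≢ 0 → Odd (incol D φ i v)))

IsWeakOddColoring : ∀ {n k} (D : Digraph n) → ArcColoring D k → Set
IsWeakOddColoring {n} D φ = ∀ (v : Fin n) → WO D φ v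

HasWeakOddColoring : ∀ {n} → Digraph n → ℕ → Set
HasWeakOddColoring D k = Σ (ArcColoring D k) (λ φ → IsWeakOddColoring D φ)

WeakOddIndexIs : ∀ {n} → Digraph n → ℕ → Set
WeakOddIndexIs D k =
  HasWeakOddColoring D k × (∀ j → j Data.Nat.< k → ¬ HasWeakOddColoring D j)

Peripheral : ∀ {n} → Digraph n → Fin n → Set
Peripheral D v = outdeg D v ≡ 0 ⊎ indeg D v ≡ 0

ExactlyOnePeripheral : ∀ {n} → Digraph n → Set
ExactlyOnePeripheral {n} D =
  Σ (Fin n) (λ v → Peripheral D v × (∀ w → Peripheral D w → w ≡ v))

EvenDigraph : ∀ {n} → Digraph n → Set
EvenDigraph {n} D = ∀ (v : Fin n) → Even (deg D v)

AllSemiDegreesOddOrZero : ∀ {n} → Digraph n → Set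
AllSemiDegreesOddOrZero {n} D =
  ∀ (v : Fin n) → (Odd (outdeg D v) ⊎ outdeg D v ≡ 0)
                × (Odd (indeg D v) ⊎ indeg D v ≡ 0)

{-# OPTIONS --safe #-}
module Submission where

open import Defs
open import Data.Nat using (ℕ; zero; suc; _+_; _%_; _≤_; _≥_; s≤s)
open import Data.Nat.Properties using (+-comm) renaming (_≟_ to _≟ℕ_)
open import Data.Bool using (Bool; true; false; T; _∧_; _xor_; not; if_then_else_)
open import Data.Bool.Properties using (xor-∧-commutativeRing; xor-same; xor-comm; xor-identityʳ; xor-inverseʳ; ∧-comm; ∧-distribˡ-xor; not-involutive; ∧-identityʳ; ∧-zeroʳ; ∨-comm; T-≡; ¬-not) renaming (_≟_ to _≟ᵇ_)
open import Data.Bool.Solver using (module xor-∧-Solver)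
open import Data.Empty using (⊥-elim)
open import Data.Unit using (tt)
open import Data.Fin using (Fin; _≟_) renaming (zero to fzero; suc to fsuc)
open import Data.Fin.Properties using (any?; all?; ¬∀⟶∃¬)
open import Data.Product using (∃; ∃₂; _×_; _,_; proj₁; proj₂)
open import Data.Sum using (_⊎_; inj₁; inj₂; [_,_]′; swap)
open import Function using (_∘_; case_of_; Equivalence)
open import Relation.Nullary using (¬_; Dec; yes; no; does; contradiction; ⌊_⌋)
open import Relation.Nullary.Decidable using (dec-true; dec-false; _×-dec_; _⊎-dec_; ¬?)
open import Relation.Binary.PropositionalEquality using (_≡_; _≢_; _≗_; refl; sym; trans; cong; cong₂; subst; ≢-sym; module ≡-Reasoning)
open import Algebra.Bundles using (CommutativeRing)
open import Algebra.Properties.CommutativeMonoid.Sum (CommutativeRing.+-commutativeMonoid xor-∧-commutativeRing) using (sum; sum-cong-≗; sum-replicate-zero; ∑-distrib-+; ∑-comm)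
open import Algebra.Properties.Semiring.Sum (CommutativeRing.semiring xor-∧-commutativeRing) using (*-distribʳ-sum)

-- View an arc u w as an edge between the out-side of u and the in-side of w. A color class is then an edge
-- set of a bipartite graph, and (WO) prescribes the parities of its degrees, so that colorings come from
-- T-joins: an edge set with prescribed degree parities exists if the support of the prescription can be
-- linked by paths to one side x and has even size. The first color class is a join with odd degree at every
-- nonempty side, except that
-- * if the number of nonempty sides is odd, a vertex of odd degree can use the second color instead, which
--   flips its odd side;
-- * if D is even and p is its only peripheral vertex, p uses a third color on a single arc.
-- The graph is connected up to empty sides when there is a source or a sink, and otherwise, unless all
-- semi-degrees are odd, up to one isolated edge. Conversely, with two colors in an even digraph each
-- nonperipheral vertex contributes an even and each peripheral vertex an odd number to the degree sum of the
-- first class, so the number of peripheral vertices is even.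

-- Parities of natural numbers and of counts.

odd : ℕ → Bool
odd zero    = false
odd (suc m) = not (odd m)

odd⇒Odd : ∀ m → odd m ≡ true → Odd m
odd⇒Odd (suc zero)    _ = refl
odd⇒Odd (suc (suc m)) p = odd⇒Odd m (trans (sym (not-involutive (odd m))) p)

Odd⇒odd : ∀ m → Odd m → odd m ≡ true
Odd⇒odd (suc zero)    _ = refl
Odd⇒odd (suc (suc m)) p = cong (not ∘ not) (Odd⇒odd m p)

Even⇒odd : ∀ m → Even m → odd m ≡ false
Even⇒odd zero          _ = refl
Even⇒odd (suc (suc m)) p = cong (not ∘ not) (Even⇒odd m p)

odd⇒Even : ∀ m → odd m ≡ false → Even m
odd⇒Even zero          _ = refl
odd⇒Even (suc (suc m)) p = odd⇒Even m (trans (sym (not-involutive (odd m))) p)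

odd-+ : ∀ m n → odd (m + n) ≡ odd m xor odd n
odd-+ zero    n = refl
odd-+ (suc m) n rewrite odd-+ m n with odd m | odd n
... | false | _     = refl
... | true  | false = refl
... | true  | true  = refl

-- The sums are taken in the field with two elements, where addition is `xor`, so `sum p` is the
-- parity of the number of true values.
odd-count : ∀ n (p : Fin n → Bool) → odd (count n p) ≡ sum p
odd-count zero    p = refl
odd-count (suc n) p with p fzero
... | true  = cong not (odd-count n (p ∘ fsuc))
... | false = odd-count n (p ∘ fsuc)

sum⇒Odd : ∀ {n} {p q : Fin n → Bool} → p ≗ q → sum q ≡ true → Odd (count n p)
sum⇒Odd {n} {p} e h = odd⇒Odd (count n p) (trans (odd-count n p) (trans (sum-cong-≗ e) h))

count-cong : ∀ n {p q : Fin n → Bool} → p ≗ q → count n p ≡ count n q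
count-cong zero    e = refl
count-cong (suc n) {p} {q} e with p fzero | q fzero | e fzero
... | true  | .true  | refl = cong suc (count-cong n (e ∘ fsuc))
... | false | .false | refl = count-cong n (e ∘ fsuc)

count-nonzero : ∀ n {p : Fin n → Bool} v → p v ≡ true → count n p ≢ 0
count-nonzero (suc n) {p} fzero    e c with p fzero
count-nonzero (suc n) {p} fzero    e () | true
count-nonzero (suc n) {p} (fsuc v) e c with p fzero
count-nonzero (suc n) {p} (fsuc v) e () | true
... | false = count-nonzero n v e c

count-witness : ∀ n {p : Fin n → Bool} → count n p ≢ 0 → ∃ λ v → p v ≡ true
count-witness zero    c = contradiction refl c
count-witness (suc n) {p} c with p fzero in e
... | true  = fzero , e
... | false = let v , pv = count-witness n c in fsuc v , pv

true≢false : ∀ {b} → b ≡ true → b ≢ false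
true≢false refl ()

-- Indicator functions of vertices.

δ : ∀ {n} → Fin n → Fin n → Bool
δ u v = does (u ≟ v)

δ-refl : ∀ {n} (v : Fin n) → δ v v ≡ true
δ-refl v = dec-true (v ≟ v) refl

δ-≢ : ∀ {n} {u v : Fin n} → u ≢ v → δ u v ≡ false
δ-≢ {u = u} {v} = dec-false (u ≟ v)

δ-sound : ∀ {n} {u v : Fin n} → δ u v ≡ true → u ≡ v
δ-sound {u = u} {v} e with u ≟ v
... | yes u≡v = u≡v

δ-sym : ∀ {n} (u v : Fin n) → δ u v ≡ δ v u
δ-sym u v with u ≟ v
... | yes refl = sym (δ-refl u)
... | no  u≢v  = sym (δ-≢ (≢-sym u≢v))

sum-δ : ∀ {n} (f : Fin n → Bool) v → sum (λ i → f i ∧ δ i v) ≡ f v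
sum-δ {suc n} f fzero
  rewrite sum-cong-≗ {n} (λ i → ∧-zeroʳ (f (fsuc i))) | sum-replicate-zero n
  = trans (xor-identityʳ _) (∧-identityʳ _)
sum-δ {suc n} f (fsuc v)
  rewrite ∧-zeroʳ (f fzero) = sum-δ (f ∘ fsuc) v

-- Sides of the bipartite graph and their degree parities.

-- inj₁ v is the out-side of v and inj₂ v its in-side.
Semi : ℕ → Set
Semi n = Fin n ⊎ Fin n

vertex : ∀ {n} → Semi n → Fin n
vertex = [ (λ v → v) , (λ v → v) ]′

semideg : ∀ {n} → Digraph n → Semi n → ℕ
semideg D (inj₁ v) = outdeg D v
semideg D (inj₂ v) = indeg D v

unit : ∀ {n} → Semi n → Semi n → Bool
unit (inj₁ u) (inj₁ v) = δ u v
unit (inj₁ u) (inj₂ v) = false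
unit (inj₂ u) (inj₁ v) = false
unit (inj₂ u) (inj₂ v) = δ u v

-- Degrees modulo two in the bipartite graph with edge set `H`. The map is linear over the field
-- with two elements, so it respects symmetric differences.
boundary : ∀ {n} → (Fin n → Fin n → Bool) → Semi n → Bool
boundary H (inj₁ v) = sum (λ w → H v w)
boundary H (inj₂ v) = sum (λ w → H w v)

boundary-⊕ : ∀ {n} (G H : Fin n → Fin n → Bool) x →
  boundary (λ u w → G u w xor H u w) x ≡ boundary G x xor boundary H x
boundary-⊕ G H (inj₁ v) = ∑-distrib-+ (G v) (H v)
boundary-⊕ G H (inj₂ v) = ∑-distrib-+ (λ w → G w v) (λ w → H w v)

-- T-joins and their construction from paths.

record TJoin {n} (D : Digraph n) (S : Semi n → Bool) : Set where
  field
    join          : Fin n → Fin n → Bool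
    join⊆arc      : ∀ u w → join u w ≡ true → arc D u w ≡ true
    boundary-join : ∀ x → boundary join x ≡ S x
open TJoin

-- The parity of the size of `S`, which is the obstruction to a join inside one component.
total : ∀ {n} → (Semi n → Bool) → Bool
total S = sum (S ∘ inj₁) xor sum (S ∘ inj₂)

total-⊕ : ∀ {n} (R S : Semi n → Bool) → total (λ x → R x xor S x) ≡ total R xor total S
total-⊕ R S
  rewrite ∑-distrib-+ (R ∘ inj₁) (S ∘ inj₁) | ∑-distrib-+ (R ∘ inj₂) (S ∘ inj₂)
  = solve 4 (λ a b c d → (a :+ b) :+ (c :+ d) := (a :+ c) :+ (b :+ d)) refl
      (sum (R ∘ inj₁)) (sum (S ∘ inj₁)) (sum (R ∘ inj₂)) (sum (S ∘ inj₂))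
  where open xor-∧-Solver

sum-δ-row : ∀ {n} (v : Fin n) → sum (δ v) ≡ true
sum-δ-row v = trans (sum-cong-≗ (δ-sym v)) (sum-δ (λ _ → true) v)

total-unit : ∀ {n} (x : Semi n) → total (unit x) ≡ true
total-unit {n} (inj₁ u) rewrite sum-δ-row u | sum-replicate-zero n = refl
total-unit {n} (inj₂ u) rewrite sum-replicate-zero n = sum-δ-row u

-- Handshake argument: each edge is counted once at an out-side and once at an in-side.
total-boundary : ∀ {n} (H : Fin n → Fin n → Bool) → total (boundary H) ≡ false
total-boundary {n} H rewrite ∑-comm H = xor-same (sum (λ w → sum (λ u → H u w)))

module _ {n : ℕ} {D : Digraph n} where

  join-cong : ∀ {R S : Semi n → Bool} → R ≗ S → TJoin D R → TJoin D S
  join-cong e J .join              = join J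
  join-cong e J .join⊆arc          = join⊆arc J
  join-cong e J .boundary-join x   = trans (boundary-join J x) (e x)

  join-∅ : TJoin D (λ _ → false)
  join-∅ .join _ _                = false
  join-∅ .join⊆arc _ _ ()
  join-∅ .boundary-join (inj₁ _)  = sum-replicate-zero n
  join-∅ .boundary-join (inj₂ _)  = sum-replicate-zero n

  join-⊕ : ∀ {R S : Semi n → Bool} → TJoin D R → TJoin D S → TJoin D (λ x → R x xor S x)
  join-⊕ I J .join u w = join I u w xor join J u w
  join-⊕ I J .join⊆arc u w e with join I u w in eI
  ... | true  = join⊆arc I u w eI
  ... | false = join⊆arc J u w e
  join-⊕ I J .boundary-join x =
    trans (boundary-⊕ (join I) (join J) x) (cong₂ _xor_ (boundary-join I x) (boundary-join J x))

  join-∑ : ∀ {m} (S : Fin m → Semi n → Bool) → (∀ i → TJoin D (S i)) → TJoin D (λ x → sum (λ i → S i x))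
  join-∑ {zero}  S J = join-∅
  join-∑ {suc m} S J = join-⊕ (J fzero) (join-∑ (S ∘ fsuc) (J ∘ fsuc))

  -- Asks for a join only where the indicator `b` is true; otherwise the empty edge set serves.
  join-if : ∀ b {S : Semi n → Bool} → (b ≡ true → TJoin D S) → TJoin D (λ x → b ∧ S x)
  join-if true  J = J refl
  join-if false J = join-∅

  join-arc : ∀ {u w} → arc D u w ≡ true → TJoin D (λ x → unit (inj₁ u) x xor unit (inj₂ w) x)
  join-arc {u} {w} uw .join a b = δ u a ∧ δ w b
  join-arc {u} {w} uw .join⊆arc a b e with u ≟ a | w ≟ b
  ... | yes refl | yes refl = uw
  join-arc {u} {w} uw .boundary-join (inj₁ v) = begin
    sum (λ b → δ u v ∧ δ w b)  ≡⟨ sum-cong-≗ (λ b → cong (δ u v ∧_) (δ-sym w b)) ⟩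
    sum (λ b → δ u v ∧ δ b w)  ≡⟨ sum-δ (λ _ → δ u v) w ⟩
    δ u v                      ≡⟨ xor-identityʳ _ ⟨
    δ u v xor false            ∎
    where open ≡-Reasoning
  join-arc {u} {w} uw .boundary-join (inj₂ v) = begin
    sum (λ a → δ u a ∧ δ w v)  ≡⟨ sum-cong-≗ (λ a → trans (cong (_∧ δ w v) (δ-sym u a)) (∧-comm (δ a u) (δ w v))) ⟩
    sum (λ a → δ w v ∧ δ a u)  ≡⟨ sum-δ (λ _ → δ w v) u ⟩
    δ w v                      ∎
    where open ≡-Reasoning

-- A path matters only through its edge set, whose odd sides are its two ends. Repeated edges of a
-- walk need no care, since they cancel modulo two.
record Linked {n} (D : Digraph n) (x y : Semi n) : Set where
  constructor link
  field path : TJoin D (λ z → unit x z xor unit y z)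
open Linked

module _ {n : ℕ} {D : Digraph n} where

  linked-arc : ∀ {u w} → arc D u w ≡ true → Linked D (inj₁ u) (inj₂ w)
  linked-arc uw = link (join-arc uw)

  linked-sym : ∀ {x y} → Linked D x y → Linked D y x
  linked-sym {x} {y} (link xy) = link (join-cong (λ z → xor-comm (unit x z) (unit y z)) xy)

  linked-trans : ∀ {x y z} → Linked D x y → Linked D y z → Linked D x z
  linked-trans {x} {y} {z} (link xy) (link yz) =
    link (join-cong (λ t → cancel (unit x t) (unit y t) (unit z t)) (join-⊕ xy yz))
    where
    cancel : ∀ a b c → (a xor b) xor (b xor c) ≡ a xor c
    cancel = solve 3 (λ a b c → (a :+ b) :+ (b :+ c) := a :+ c) refl
      where open xor-∧-Solver

  -- Add up one path from `x` to each member of `S`. Each member is the far end of one path, while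
  -- `x` is an end of all of them and so changes parity `total S` times.
  join-linked : ∀ x (S : Semi n → Bool) → (∀ y → S y ≡ true → Linked D x y) →
    TJoin D (λ y → S y xor (total S ∧ unit x y))
  join-linked x S linked = join-cong eq
    (join-⊕ (half inj₁) (half inj₂))
    where
    half : (side : Fin n → Semi n) →
      TJoin D (λ y → sum (λ i → S (side i) ∧ (unit x y xor unit (side i) y)))
    half side = join-∑ (λ i y → S (side i) ∧ (unit x y xor unit (side i) y))
      (λ i → join-if (S (side i)) (λ e → path (linked (side i) e)))
    split : ∀ (side : Fin n → Semi n) y →
      sum (λ i → S (side i) ∧ (unit x y xor unit (side i) y))
      ≡ (sum (S ∘ side) ∧ unit x y) xor sum (λ i → S (side i) ∧ unit (side i) y)
    split side y = begin
      sum (λ i → S (side i) ∧ (unit x y xor unit (side i) y))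
        ≡⟨ sum-cong-≗ (λ i → ∧-distribˡ-xor (S (side i)) (unit x y) (unit (side i) y)) ⟩
      sum (λ i → (S (side i) ∧ unit x y) xor (S (side i) ∧ unit (side i) y))
        ≡⟨ ∑-distrib-+ (λ i → S (side i) ∧ unit x y) (λ i → S (side i) ∧ unit (side i) y) ⟩
      sum (λ i → S (side i) ∧ unit x y) xor sum (λ i → S (side i) ∧ unit (side i) y)
        ≡⟨ cong (_xor _) (*-distribʳ-sum (unit x y) (S ∘ side)) ⟨
      (sum (S ∘ side) ∧ unit x y) xor sum (λ i → S (side i) ∧ unit (side i) y) ∎
      where open ≡-Reasoning
    sum-zero : (f : Fin n → Bool) → sum (λ i → f i ∧ false) ≡ false
    sum-zero f = trans (sum-cong-≗ (λ i → ∧-zeroʳ (f i))) (sum-replicate-zero n)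
    collect : ∀ y → sum (λ i → S (inj₁ i) ∧ unit (inj₁ i) y) xor sum (λ i → S (inj₂ i) ∧ unit (inj₂ i) y) ≡ S y
    collect (inj₁ v) rewrite sum-δ (S ∘ inj₁) v | sum-zero (S ∘ inj₂) = xor-identityʳ _
    collect (inj₂ v) rewrite sum-zero (S ∘ inj₁) = sum-δ (S ∘ inj₂) v
    eq : ∀ y → sum (λ i → S (inj₁ i) ∧ (unit x y xor unit (inj₁ i) y))
                 xor sum (λ i → S (inj₂ i) ∧ (unit x y xor unit (inj₂ i) y))
               ≡ S y xor (total S ∧ unit x y)
    eq y = begin
      sum (λ i → S (inj₁ i) ∧ (unit x y xor unit (inj₁ i) y))
        xor sum (λ i → S (inj₂ i) ∧ (unit x y xor unit (inj₂ i) y))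
        ≡⟨ cong₂ _xor_ (split inj₁ y) (split inj₂ y) ⟩
      ((a ∧ u) xor p) xor ((b ∧ u) xor q)
        ≡⟨ solve 5 (λ a b u p q → (a :* u :+ p) :+ (b :* u :+ q) := (p :+ q) :+ (a :+ b) :* u) refl a b u p q ⟩
      (p xor q) xor ((a xor b) ∧ u)
        ≡⟨ cong (_xor (total S ∧ u)) (collect y) ⟩
      S y xor (total S ∧ u) ∎
      where
      open ≡-Reasoning
      open xor-∧-Solver using (solve; _:=_; _:+_; _:*_)
      a = sum (S ∘ inj₁)
      b = sum (S ∘ inj₂)
      u = unit x y
      p = sum (λ i → S (inj₁ i) ∧ unit (inj₁ i) y)
      q = sum (λ i → S (inj₂ i) ∧ unit (inj₂ i) y)

-- Nonempty sides and reversal.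

module _ {n : ℕ} (D : Digraph n) where

  -- The sides on which (WO) imposes a condition.
  active : Semi n → Bool
  active x = not (does (semideg D x ≟ℕ 0))

  active-nonzero : ∀ x → semideg D x ≢ 0 → active x ≡ true
  active-nonzero x d≢0 = cong not (dec-false (semideg D x ≟ℕ 0) d≢0)

  active-zero : ∀ x → semideg D x ≡ 0 → active x ≡ false
  active-zero x d≡0 = cong not (dec-true (semideg D x ≟ℕ 0) d≡0)

  active⇒nonzero : ∀ x → active x ≡ true → semideg D x ≢ 0
  active⇒nonzero x e d≡0 = true≢false e (active-zero x d≡0)

  odd-semideg : ∀ x → odd (semideg D x) ≡ boundary (arc D) x
  odd-semideg (inj₁ v) = odd-count n (λ w → arc D v w)
  odd-semideg (inj₂ v) = odd-count n (λ w → arc D w v)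

  arc⇒outdeg : ∀ {u w} → arc D u w ≡ true → outdeg D u ≢ 0
  arc⇒outdeg {u} {w} = count-nonzero n w

  arc⇒indeg : ∀ {u w} → arc D u w ≡ true → indeg D w ≢ 0
  arc⇒indeg {u} {w} = count-nonzero n u

boundary-cong : ∀ {n} {G H : Fin n → Fin n → Bool} → (∀ u w → G u w ≡ H u w) → boundary G ≗ boundary H
boundary-cong e (inj₁ v) = sum-cong-≗ (λ w → e v w)
boundary-cong e (inj₂ v) = sum-cong-≗ (λ w → e w v)

unit-refl : ∀ {n} (x : Semi n) → unit x x ≡ true
unit-refl (inj₁ v) = δ-refl v
unit-refl (inj₂ v) = δ-refl v

unit-sound : ∀ {n} {x y : Semi n} → unit x y ≡ true → x ≡ y
unit-sound {x = inj₁ _} {inj₁ _} e = cong inj₁ (δ-sound e)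
unit-sound {x = inj₂ _} {inj₂ _} e = cong inj₂ (δ-sound e)

unit-≢ : ∀ {n} {x y : Semi n} → x ≢ y → unit x y ≡ false
unit-≢ {x = x} {y} x≢y = ¬-not (x≢y ∘ unit-sound {x = x} {y})

-- Turns sinks into sources, so that the arguments about peripheral vertices are given for sources
-- only.
reverse : ∀ {n} → Digraph n → Digraph n
reverse D .arc u v   = arc D v u
reverse D .loopless  = loopless D

reverse-coloring : ∀ {n k} {D : Digraph n} → HasWeakOddColoring (reverse D) k → HasWeakOddColoring D k
reverse-coloring {D = D} (φ , wo) = (λ u v → φ v u) , λ v → case wo v of λ where
  (inj₁ (o , i))     → inj₁ (i , o)
  (inj₂ (c , o , i)) → inj₂ (c , i , o)

-- Colorings obtained from T-joins.

module _ {n k : ℕ} {D : Digraph n} where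

  -- The coloring `c` is given on all pairs; the conjunction discards its values off the arcs.
  colorClass : (Fin n → Fin n → Fin k) → Fin k → Fin n → Fin n → Bool
  colorClass c i u w = arc D u w ∧ ⌊ c u w ≟ i ⌋

  colorClass-WO : ∀ (c : Fin n → Fin n → Fin k) v i →
    (∀ x → vertex x ≡ v → semideg D x ≢ 0 → boundary (colorClass c i) x ≡ true) →
    WO D (λ u w _ → c u w) v
  colorClass-WO c v i h = inj₂ (i ,
    (λ d≢0 → sum⇒Odd (λ w → colIs-const (arc D v w) (c v w)) (h (inj₁ v) refl d≢0)) ,
    (λ d≢0 → sum⇒Odd (λ w → colIs-const (arc D w v) (c w v)) (h (inj₂ v) refl d≢0)))
    where
    colIs-const : ∀ b a → colIs b (λ _ → a) i ≡ b ∧ ⌊ a ≟ i ⌋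
    colIs-const true  a = refl
    colIs-const false a = refl

module _ {n : ℕ} {D : Digraph n} {S : Semi n → Bool} (J : TJoin D S) where

  joinColoring : ∀ {k} → (Fin n → Fin n → Fin k) → Fin n → Fin n → Fin (suc k)
  joinColoring c u w = if join J u w then fzero else fsuc (c u w)

  joinColoring-zero : ∀ {k} (c : Fin n → Fin n → Fin k) x →
    boundary (colorClass {D = D} (joinColoring c) fzero) x ≡ S x
  joinColoring-zero c x = trans (boundary-cong eq x) (boundary-join J x)
    where
    eq : ∀ u w → colorClass {D = D} (joinColoring c) fzero u w ≡ join J u w
    eq u w with join J u w in e
    ... | true  = trans (∧-identityʳ _) (join⊆arc J u w e)
    ... | false = ∧-zeroʳ _

  -- With two colors the second class is the complement of the join in the arc set, and boundaries
  -- add.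
  joinColoring-one : ∀ x →
    boundary (colorClass {D = D} (joinColoring (λ _ _ → fzero {0})) (fsuc fzero)) x ≡ odd (semideg D x) xor S x
  joinColoring-one x =
    trans (boundary-cong eq x)
      (trans (boundary-⊕ (arc D) (join J) x)
        (cong₂ _xor_ (sym (odd-semideg D x)) (boundary-join J x)))
    where
    eq : ∀ u w → colorClass {D = D} (joinColoring (λ _ _ → fzero {0})) (fsuc fzero) u w ≡ arc D u w xor join J u w
    eq u w with join J u w in e
    ... | true  rewrite join⊆arc J u w e = refl
    ... | false = trans (∧-identityʳ _) (sym (xor-identityʳ _))

  -- Since `p q` lies outside the join, it does receive the last color, and no other arc does. The
  -- class is thus a single arc.
  joinColoring-two : ∀ {p q} → arc D p q ≡ true → join J p q ≡ false → ∀ x →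
    boundary (colorClass {D = D} (joinColoring (λ u w → if δ p u ∧ δ q w then fsuc (fzero {0}) else fzero))
      (fsuc (fsuc fzero))) x
    ≡ unit (inj₁ p) x xor unit (inj₂ q) x
  joinColoring-two {p} {q} pq ¬Jpq x = trans (boundary-cong eq x) (boundary-join (join-arc {D = D} pq) x)
    where
    eq : ∀ u w → colorClass {D = D} (joinColoring (λ u w → if δ p u ∧ δ q w then fsuc (fzero {0}) else fzero))
      (fsuc (fsuc fzero)) u w ≡ δ p u ∧ δ q w
    eq u w with p ≟ u | q ≟ w
    eq u w | yes refl | yes refl rewrite pq | ¬Jpq = refl
    eq u w | no _     | _ with join J u w
    ... | true  = ∧-zeroʳ _
    ... | false = ∧-zeroʳ _
    eq u w | yes _ | no _ with join J u w
    ... | true  = ∧-zeroʳ _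
    ... | false = ∧-zeroʳ _

-- Every vertex uses color 0.
active-join⇒2-coloring : ∀ {n} {D : Digraph n} → TJoin D (active D) → HasWeakOddColoring D 2
active-join⇒2-coloring {D = D} J = (λ u w _ → joinColoring J (λ _ _ → fzero) u w) , λ v →
  colorClass-WO (joinColoring J (λ _ _ → fzero)) v fzero λ x _ d≢0 →
    trans (joinColoring-zero J _ x) (active-nonzero D x d≢0)

-- The vertex of y uses color 1, all others use color 0.
flipped-join⇒2-coloring : ∀ {n} {D : Digraph n} (y : Semi n) →
  (∀ x → vertex x ≡ vertex y → odd (semideg D x) ≡ unit y x) →
  TJoin D (λ x → active D x xor unit y x) → HasWeakOddColoring D 2
flipped-join⇒2-coloring {D = D} y parity J = (λ u w _ → c u w) , wo
  where
  c = joinColoring J (λ _ _ → fzero)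
  wo : IsWeakOddColoring D (λ u w _ → c u w)
  wo v with v ≟ vertex y
  -- At this vertex `y` is the only side of odd semi-degree. The join is even at `y` and odd at the
  -- other side if that is nonempty, so the complement of the join is odd at every nonempty side.
  ... | yes refl = colorClass-WO c v (fsuc fzero) λ x vx d≢0 → begin
    boundary (colorClass {D = D} c (fsuc fzero)) x              ≡⟨ joinColoring-one J x ⟩
    odd (semideg D x) xor (active D x xor unit y x)     ≡⟨ cong₂ (λ a b → a xor (b xor unit y x)) (parity x vx) (active-nonzero D x d≢0) ⟩
    unit y x xor not (unit y x)                         ≡⟨ xor-inverseʳ (unit y x) ⟩
    true                                                ∎
    where open ≡-Reasoning
  ... | no v≢y = colorClass-WO c v fzero λ x vx d≢0 →
    trans (joinColoring-zero J _ x)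
      (cong₂ _xor_ (active-nonzero D x d≢0) (unit-≢ {x = y} (λ y≡x → v≢y (trans (sym vx) (cong vertex (sym y≡x))))))

-- Even nonempty sides and vertices of odd degree.

count-two : ∀ n {p : Fin n → Bool} → count n p ≢ 0 → odd (count n p) ≡ false →
  ∃₂ λ v w → p v ≡ true × p w ≡ true × v ≢ w
count-two n {p} c≢0 even with count-witness n c≢0
... | v , pv with any? (λ w → (p w ≟ᵇ true) ×-dec ¬? (v ≟ w))
... | yes (w , pw , v≢w) = v , w , pv , pw , v≢w
-- Without a second witness `p` is the indicator of `v`, whose sum is odd.
... | no only = contradiction even (true≢false (begin
    odd (count n p)  ≡⟨ odd-count n p ⟩
    sum p            ≡⟨ sum-cong-≗ eq ⟩
    sum (δ v)        ≡⟨ sum-δ-row v ⟩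
    true             ∎))
  where
  open ≡-Reasoning
  eq : p ≗ δ v
  eq w with v ≟ w
  ... | yes refl = pv
  ... | no  v≢w  = ¬-not (λ pw → only (w , pw , v≢w))

evenDigraph? : ∀ {n} (D : Digraph n) → Dec (EvenDigraph D)
evenDigraph? D = all? (λ v → deg D v % 2 ≟ℕ 0)

OddOrZero : ∀ {n} → Digraph n → Semi n → Set
OddOrZero D x = Odd (semideg D x) ⊎ semideg D x ≡ 0

oddOrZero? : ∀ {n} (D : Digraph n) x → Dec (OddOrZero D x)
oddOrZero? D x = (semideg D x % 2 ≟ℕ 1) ⊎-dec (semideg D x ≟ℕ 0)

¬oddOrZero : ∀ {n} (D : Digraph n) x → ¬ OddOrZero D x → semideg D x ≢ 0 × odd (semideg D x) ≡ false
¬oddOrZero D x h = (λ d≡0 → h (inj₂ d≡0)) , ¬-not (λ o → h (inj₁ (odd⇒Odd (semideg D x) o)))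

-- Supplies the even nonempty side from which `linked-sides` starts.
¬allOddOrZero : ∀ {n} (D : Digraph n) → ¬ AllSemiDegreesOddOrZero D →
  ∃ λ x → semideg D x ≢ 0 × odd (semideg D x) ≡ false
¬allOddOrZero {n} D h with
  ¬∀⟶∃¬ n _ (λ v → oddOrZero? D (inj₁ v) ×-dec oddOrZero? D (inj₂ v)) h
... | v , bad with oddOrZero? D (inj₁ v) | oddOrZero? D (inj₂ v)
... | no ¬out | _      = inj₁ v , ¬oddOrZero D (inj₁ v) ¬out
... | yes _   | no ¬in = inj₂ v , ¬oddOrZero D (inj₂ v) ¬in
... | yes out | yes in′ = contradiction (out , in′) bad

-- An odd degree is the sum of two semi-degrees of different parity; `y` is the odd one of the two
-- sides.
odd-degree-vertex : ∀ {n} (D : Digraph n) → ¬ EvenDigraph D →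
  ∃ λ y → ∀ x → vertex x ≡ vertex y → odd (semideg D x) ≡ unit y x
odd-degree-vertex {n} D h with ¬∀⟶∃¬ n _ (λ v → deg D v % 2 ≟ℕ 0) h
... | v , ¬even with odd (outdeg D v) in o | odd (indeg D v) in i
... | true  | true  = contradiction (odd⇒Even (deg D v) (trans (odd-+ (outdeg D v) _) (cong₂ _xor_ o i))) ¬even
... | false | false = contradiction (odd⇒Even (deg D v) (trans (odd-+ (outdeg D v) _) (cong₂ _xor_ o i))) ¬even
... | true  | false = inj₁ v , λ where
  (inj₁ .v) refl → trans o (sym (δ-refl v))
  (inj₂ .v) refl → i
... | false | true  = inj₂ v , λ where
  (inj₁ .v) refl → o
  (inj₂ .v) refl → trans i (sym (δ-refl v))

another-vertex : ∀ {n} → n ≥ 2 → (v : Fin n) → ∃ λ w → w ≢ v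
another-vertex (s≤s (s≤s _)) fzero    = fsuc fzero , λ ()
another-vertex (s≤s (s≤s _)) (fsuc v) = fzero , λ ()

-- There are as many out-sides as in-sides, so the two sums cancel.
total-true : ∀ {n} (S : Semi n → Bool) → (∀ x → S x ≡ true) → total S ≡ false
total-true {n} S h
  rewrite sum-cong-≗ (λ v → h (inj₁ v)) | sum-cong-≗ (λ v → h (inj₂ v)) = xor-same (sum {n} (λ _ → true))

-- Semicomplete digraphs with a source.

module _ {n : ℕ} (D : Digraph n) (semicomplete : Semicomplete D) where

  adjacent : ∀ {u v} → u ≢ v → arc D u v ≡ true ⊎ arc D v u ≡ true
  adjacent {u} {v} u≢v with arc D u v | arc D v u | semicomplete u v u≢v
  ... | true  | _    | _ = inj₁ refl
  ... | false | true | _ = inj₂ refl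

  arc-from-source : ∀ {p v} → indeg D p ≡ 0 → v ≢ p → arc D p v ≡ true
  arc-from-source d≡0 v≢p with adjacent v≢p
  ... | inj₁ vp = contradiction d≡0 (arc⇒indeg D vp)
  ... | inj₂ pv = pv

  arc-to-sink : ∀ {p v} → outdeg D p ≡ 0 → v ≢ p → arc D v p ≡ true
  arc-to-sink d≡0 v≢p with adjacent v≢p
  ... | inj₁ vp = vp
  ... | inj₂ pv = contradiction d≡0 (arc⇒outdeg D pv)

  -- The source sends an arc to the in-side of every other vertex, and a nonempty out-side is one
  -- arc away from such an in-side.
  linked-source : ∀ {p} → indeg D p ≡ 0 → ∀ x → semideg D x ≢ 0 → Linked D (inj₁ p) x
  linked-source {p} d≡0 (inj₂ w) d≢0 = linked-arc (arc-from-source d≡0 (λ { refl → d≢0 d≡0 }))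
  linked-source {p} d≡0 (inj₁ u) d≢0 =
    let w , uw = count-witness n d≢0 in
    linked-trans (linked-source d≡0 (inj₂ w) (arc⇒indeg D uw)) (linked-sym (linked-arc uw))

  -- All sides are nonempty except two, the in-side of `p` and the out-side of `q`.
  total-active-source-sink : ∀ {p q} → indeg D p ≡ 0 → outdeg D q ≡ 0 → total (active D) ≡ false
  total-active-source-sink {p} {q} inp outq = begin
    total (active D)                                     ≡⟨ cong₂ _xor_ (sum-cong-≗ (eq ∘ inj₁)) (sum-cong-≗ (eq ∘ inj₂)) ⟩
    total (λ x → true xor (unit (inj₁ q) x xor unit (inj₂ p) x))
      ≡⟨ total-⊕ {n} (λ _ → true) (λ x → unit (inj₁ q) x xor unit (inj₂ p) x) ⟩
    total {n} (λ _ → true) xor total (λ x → unit (inj₁ q) x xor unit (inj₂ p) x)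
      ≡⟨ cong₂ _xor_ (total-true {n} (λ _ → true) (λ _ → refl)) (total-⊕ (unit (inj₁ q)) (unit (inj₂ p))) ⟩
    total (unit (inj₁ q)) xor total (unit (inj₂ p))      ≡⟨ cong₂ _xor_ (total-unit (inj₁ q)) (total-unit (inj₂ p)) ⟩
    false                                                ∎
    where
    open ≡-Reasoning
    eq : ∀ x → active D x ≡ true xor (unit (inj₁ q) x xor unit (inj₂ p) x)
    eq (inj₁ v) with q ≟ v
    ... | yes refl = active-zero D (inj₁ q) outq
    ... | no  q≢v  = active-nonzero D (inj₁ v) (arc⇒outdeg D (arc-to-sink outq (≢-sym q≢v)))
    eq (inj₂ v) with p ≟ v
    ... | yes refl = active-zero D (inj₂ p) inp
    ... | no  p≢v  = active-nonzero D (inj₂ v) (arc⇒indeg D (arc-from-source inp (≢-sym p≢v)))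

  -- All nonempty sides are linked to the source, so only the parity of their number matters. If it
  -- is odd, there is no sink, so `p` is the only peripheral vertex and `D` cannot be even.
  source⇒2-coloring : ∀ {p} → n ≥ 2 → indeg D p ≡ 0 → ¬ (EvenDigraph D × ExactlyOnePeripheral D) →
    HasWeakOddColoring D 2
  source⇒2-coloring {p} n≥2 inp h with total (active D) in tot
  ... | false = active-join⇒2-coloring (join-cong eq (join-linked (inj₁ p) (active D) linked))
    where
    linked : ∀ x → active D x ≡ true → Linked D (inj₁ p) x
    linked x e = linked-source inp x (active⇒nonzero D x e)
    eq : ∀ x → active D x xor (total (active D) ∧ unit (inj₁ p) x) ≡ active D x
    eq x rewrite tot = xor-identityʳ _
  ... | true with evenDigraph? D
  ... | yes even = contradiction (even , p , inj₂ inp , unique) h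
    where
    unique : ∀ w → Peripheral D w → w ≡ p
    unique w (inj₁ outw) = contradiction (total-active-source-sink inp outw) (true≢false tot)
    unique w (inj₂ inw) with w ≟ p
    ... | yes w≡p = w≡p
    ... | no  w≢p = contradiction inw (arc⇒indeg D (arc-from-source inp w≢p))
  -- Flipping `y` makes the prescription even. It stays within the nonempty sides, because `y` has
  -- odd and hence nonzero semi-degree.
  ... | no ¬even = flipped-join⇒2-coloring y parity (join-cong eq (join-linked (inj₁ p) S linked))
    where
    y = proj₁ (odd-degree-vertex D ¬even)
    parity = proj₂ (odd-degree-vertex D ¬even)
    S : Semi n → Bool
    S x = active D x xor unit y x
    y-active : semideg D y ≢ 0
    y-active d≡0 = true≢false (trans (parity y refl) (unit-refl y)) (cong odd d≡0)
    linked : ∀ x → S x ≡ true → Linked D (inj₁ p) x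
    linked x e with active D x in a
    ... | true  = linked-source inp x (active⇒nonzero D x a)
    ... | false with refl ← unit-sound {x = y} {x} e = linked-source inp y y-active
    eq : ∀ x → S x xor (total S ∧ unit (inj₁ p) x) ≡ S x
    eq x rewrite total-⊕ (active D) (unit y) | tot | total-unit y = xor-identityʳ _

  -- Semicomplete digraphs without peripheral vertices.

  linked-sides : (x : Semi n) → semideg D x ≢ 0 → odd (semideg D x) ≡ false → ∃ λ c → Linked D (inj₁ c) (inj₂ c)
  linked-sides (inj₁ v) d≢0 even with count-two n d≢0 even
  ... | a , b , va , vb , a≢b with adjacent a≢b
  -- The path runs from the out-side of `a` to the in-side of `b`, then to the out-side of `v`, then
  -- to the in-side of `a`. The other cases are analogous.
  ... | inj₁ ab = a , linked-trans (linked-arc ab)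
                        (linked-trans (linked-sym (linked-arc vb)) (linked-arc va))
  ... | inj₂ ba = b , linked-trans (linked-arc ba)
                        (linked-trans (linked-sym (linked-arc va)) (linked-arc vb))
  linked-sides (inj₂ v) d≢0 even with count-two n d≢0 even
  ... | a , b , av , bv , a≢b with adjacent a≢b
  ... | inj₁ ab = b , linked-trans (linked-arc bv)
                        (linked-trans (linked-sym (linked-arc av)) (linked-arc ab))
  ... | inj₂ ba = a , linked-trans (linked-arc av)
                        (linked-trans (linked-sym (linked-arc bv)) (linked-arc ba))

module _ {n : ℕ} (D : Digraph n) (semicomplete : Semicomplete D) {c : Fin n}
  (c⁺~c⁻ : Linked D (inj₁ c) (inj₂ c)) (d≢0 : ∀ x → semideg D x ≢ 0) where

  -- Near sides are linked to c. At most one out-side and at most one in-side are not near: an edge between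
  -- these two has to be treated separately, and if there is none, they are linked to c through near neighbors.
  Near : Semi n → Set
  Near (inj₁ u) = ∃ λ w → arc D u w ≡ true × (w ≡ c ⊎ arc D c w ≡ true)
  Near (inj₂ w) = ∃ λ u → arc D u w ≡ true × (u ≡ c ⊎ arc D u c ≡ true)

  near? : ∀ x → Dec (Near x)
  near? (inj₁ u) = any? (λ w → (arc D u w ≟ᵇ true) ×-dec ((w ≟ c) ⊎-dec (arc D c w ≟ᵇ true)))
  near? (inj₂ w) = any? (λ u → (arc D u w ≟ᵇ true) ×-dec ((u ≟ c) ⊎-dec (arc D u c ≟ᵇ true)))

  -- A near side is at distance at most two from a side of `c`, and `c⁺~c⁻` leads from either side
  -- of `c` to the other.
  near⇒linked : ∀ x → Near x → Linked D (inj₁ c) x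
  near⇒linked (inj₁ u) (w , uw , inj₁ refl) = linked-trans c⁺~c⁻ (linked-sym (linked-arc uw))
  near⇒linked (inj₁ u) (w , uw , inj₂ cw)   = linked-trans (linked-arc cw) (linked-sym (linked-arc uw))
  near⇒linked (inj₂ w) (u , uw , inj₁ refl) = linked-arc uw
  near⇒linked (inj₂ w) (u , uw , inj₂ uc)   =
    linked-trans c⁺~c⁻ (linked-trans (linked-sym (linked-arc uc)) (linked-arc uw))

  -- An arc from `b` to `c` would make the out-side of `b` near. Moreover `b` is not `c`, since any
  -- out-neighbor of `c` makes the out-side of `c` near.
  far-out⇒arc : ∀ {b} → ¬ Near (inj₁ b) → arc D c b ≡ true
  far-out⇒arc {b} far with b ≟ c
  ... | yes refl = let w , cw = count-witness n (d≢0 (inj₁ c)) in contradiction (w , cw , inj₂ cw) far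
  ... | no  b≢c with adjacent D semicomplete b≢c
  ... | inj₁ bc = contradiction (c , bc , inj₁ refl) far
  ... | inj₂ cb = cb

  far-in⇒arc : ∀ {a} → ¬ Near (inj₂ a) → arc D a c ≡ true
  far-in⇒arc {a} far with a ≟ c
  ... | yes refl = let u , uc = count-witness n (d≢0 (inj₂ c)) in contradiction (u , uc , inj₂ uc) far
  ... | no  a≢c with adjacent D semicomplete a≢c
  ... | inj₁ ac = ac
  ... | inj₂ ca = contradiction (c , ca , inj₁ refl) far

  far-out-unique : ∀ {b b′} → ¬ Near (inj₁ b) → ¬ Near (inj₁ b′) → b ≡ b′
  far-out-unique {b} {b′} far far′ with b ≟ b′
  ... | yes e = e
  ... | no  b≢b′ with adjacent D semicomplete b≢b′
  ... | inj₁ bb′ = contradiction (b′ , bb′ , inj₂ (far-out⇒arc far′)) far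
  ... | inj₂ b′b = contradiction (b , b′b , inj₂ (far-out⇒arc far)) far′

  far-in-unique : ∀ {a a′} → ¬ Near (inj₂ a) → ¬ Near (inj₂ a′) → a ≡ a′
  far-in-unique {a} {a′} far far′ with a ≟ a′
  ... | yes e = e
  ... | no  a≢a′ with adjacent D semicomplete a≢a′
  ... | inj₁ aa′ = contradiction (a , aa′ , inj₂ (far-in⇒arc far)) far′
  ... | inj₂ a′a = contradiction (a′ , a′a , inj₂ (far-in⇒arc far′)) far

  total-active : total (active D) ≡ false
  total-active = total-true (active D) (λ x → active-nonzero D x (d≢0 x))

  join-even : ∀ S → total S ≡ false → (∀ x → S x ≡ true → Linked D (inj₁ c) x) → TJoin D S
  join-even S even linked = join-cong
    (λ x → trans (cong (λ t → S x xor (t ∧ unit (inj₁ c) x)) even) (xor-identityʳ _))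
    (join-linked (inj₁ c) S linked)

  -- If an arc `b a` connects the two far sides, it serves both of them. What remains is an even
  -- number of near sides, so a join for these is combined with that arc.
  active-join : TJoin D (active D)
  active-join with any? (λ b → any? (λ a → (arc D b a ≟ᵇ true) ×-dec (¬? (near? (inj₁ b)) ×-dec ¬? (near? (inj₂ a)))))
  ... | no none = join-even (active D) total-active (λ x _ → linked x)
    where
    linked : ∀ x → Linked D (inj₁ c) x
    linked x with near? x
    ... | yes near = near⇒linked x near
    linked (inj₁ u) | no far with count-witness n (d≢0 (inj₁ u))
    ... | w , uw with near? (inj₂ w)
    ... | yes near = linked-trans (near⇒linked (inj₂ w) near) (linked-sym (linked-arc uw))
    ... | no far′  = contradiction (u , w , uw , far , far′) none
    linked (inj₂ w) | no far with count-witness n (d≢0 (inj₂ w))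
    ... | u , uw with near? (inj₁ u)
    ... | yes near = linked-trans (near⇒linked (inj₁ u) near) (linked-arc uw)
    ... | no far′  = contradiction (u , w , uw , far′ , far) none
  ... | yes (b , a , ba , far-b , far-a) =
    join-cong (λ x → cancel (active D x) (e x)) (join-⊕ (join-even S even linked) (join-arc ba))
    where
    e : Semi n → Bool
    e x = unit (inj₁ b) x xor unit (inj₂ a) x
    S : Semi n → Bool
    S x = active D x xor e x
    cancel : ∀ s t → (s xor t) xor t ≡ s
    cancel = solve 2 (λ s t → (s :+ t) :+ t := s) refl
      where open xor-∧-Solver
    even : total S ≡ false
    even rewrite total-⊕ (active D) e | total-active | total-⊕ (unit (inj₁ b)) (unit (inj₂ a))
      | total-unit (inj₁ b) | total-unit (inj₂ a) = refl
    linked : ∀ x → S x ≡ true → Linked D (inj₁ c) x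
    linked x s with near? x
    ... | yes near = near⇒linked x near
    -- At a far side `active D` and `e` are both true, so `S` vanishes there.
    linked (inj₁ u) s | no far with refl ← far-out-unique far far-b
      rewrite active-nonzero D (inj₁ u) (d≢0 (inj₁ u)) | δ-refl u = case s of λ ()
    linked (inj₂ w) s | no far with refl ← far-in-unique far far-a
      rewrite active-nonzero D (inj₂ w) (d≢0 (inj₂ w)) | δ-refl w = case s of λ ()

nonperipheral⇒2-coloring : ∀ {n} {D : Digraph n} → Semicomplete D → (∀ x → semideg D x ≢ 0) →
  ¬ AllSemiDegreesOddOrZero D → HasWeakOddColoring D 2
nonperipheral⇒2-coloring {D = D} semicomplete d≢0 h =
  let x , nonzero , even = ¬allOddOrZero D h
      c , c⁺~c⁻ = linked-sides D semicomplete x nonzero even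
  in active-join⇒2-coloring (active-join D semicomplete c⁺~c⁻ d≢0)

-- Even digraphs whose only peripheral vertex is a source.

module _ {n : ℕ} (D : Digraph n) (semicomplete : Semicomplete D) (n≥2 : n ≥ 2)
  {p : Fin n} (inp : indeg D p ≡ 0) (even : EvenDigraph D)
  (nonperipheral : ∀ v → v ≢ p → outdeg D v ≢ 0) where

  arc⇒≢source : ∀ {u v} → arc D u v ≡ true → v ≢ p
  arc⇒≢source uv refl = arc⇒indeg D uv inp

  ≢source-active : ∀ x → vertex x ≢ p → semideg D x ≢ 0
  ≢source-active (inj₁ v) = nonperipheral v
  ≢source-active (inj₂ v) v≢p = arc⇒indeg D (arc-from-source D semicomplete inp v≢p)

  source-outdeg : outdeg D p ≢ 0
  source-outdeg = let q , q≢p = another-vertex n≥2 p in arc⇒outdeg D (arc-from-source D semicomplete inp q≢p)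

  source-outdeg-even : odd (outdeg D p) ≡ false
  source-outdeg-even = trans (sym (xor-identityʳ _)) (trans (sym (odd-+ (outdeg D p) 0))
    (trans (cong (λ d → odd (outdeg D p + d)) (sym inp)) (Even⇒odd (deg D p) (even p))))

  -- Otherwise an out-neighbor r of some q ≢ p has out-degree 1, and its in-neighbors are exactly p and q.
  fork : ∃ λ u → ∃₂ λ v w → u ≢ p × v ≢ w × arc D u v ≡ true × arc D u w ≡ true
  fork with any? (λ u → any? (λ v → any? (λ w →
    ¬? (u ≟ p) ×-dec (¬? (v ≟ w) ×-dec ((arc D u v ≟ᵇ true) ×-dec (arc D u w ≟ᵇ true))))))
  ... | yes (u , v , w , h) = u , v , w , h
  ... | no none = contradiction (Even⇒odd (deg D r) (even r)) (true≢false (begin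
    odd (deg D r)                           ≡⟨ odd-+ (outdeg D r) (indeg D r) ⟩
    odd (outdeg D r) xor odd (indeg D r)    ≡⟨ cong₂ _xor_ out-odd in-even ⟩
    true                                    ∎))
    where
    open ≡-Reasoning
    unique-out : ∀ {u v w} → u ≢ p → arc D u v ≡ true → arc D u w ≡ true → v ≡ w
    unique-out {u} {v} {w} u≢p uv uw with v ≟ w
    ... | yes v≡w = v≡w
    ... | no  v≢w = contradiction (u , v , w , u≢p , v≢w , uv , uw) none
    other = another-vertex n≥2 p
    q = proj₁ other
    q≢p = proj₂ other
    next = count-witness n (nonperipheral q q≢p)
    r = proj₁ next
    qr : arc D q r ≡ true
    qr = proj₂ next
    pr : arc D p r ≡ true
    pr = arc-from-source D semicomplete inp (arc⇒≢source qr)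
    arc⇒≢ : ∀ {u v} → arc D u v ≡ true → u ≢ v
    arc⇒≢ uv refl = true≢false uv (loopless D _)
    out-odd : odd (outdeg D r) ≡ true
    out-odd with odd (outdeg D r) in e
    ... | true  = refl
    -- A nonzero even out-degree gives two out-neighbors of `r`, which is a fork.
    ... | false =
      let _ , _ , rv , rw , v≢w = count-two n (nonperipheral r (arc⇒≢source qr)) e
      in contradiction (unique-out (arc⇒≢source qr) rv rw) v≢w
    in-neighbors : ∀ u → arc D u r ≡ δ p u xor δ q u
    in-neighbors u with p ≟ u | q ≟ u
    ... | yes refl | yes q≡p  = contradiction q≡p q≢p
    ... | yes refl | no _     = pr
    ... | no _     | yes refl = qr
    -- A third in-neighbor `u` of `r` is adjacent to `q`. As `q` and `u` have no out-neighbor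
    -- besides `r`, this would force `u` or `q` to equal `r`.
    ... | no p≢u   | no q≢u   = ¬-not λ ur → case adjacent D semicomplete q≢u of λ where
      (inj₁ qu) → arc⇒≢ ur (unique-out q≢p qu qr)
      (inj₂ uq) → arc⇒≢ qr (unique-out (≢-sym p≢u) uq ur)
    in-even : odd (indeg D r) ≡ false
    in-even = begin
      odd (indeg D r)              ≡⟨ odd-count n (λ u → arc D u r) ⟩
      sum (λ u → arc D u r)        ≡⟨ sum-cong-≗ in-neighbors ⟩
      sum (λ u → δ p u xor δ q u)  ≡⟨ ∑-distrib-+ (δ p) (δ q) ⟩
      sum (δ p) xor sum (δ q)      ≡⟨ cong₂ _xor_ (sum-δ-row p) (sum-δ-row q) ⟩
      false                        ∎

  -- Any parity defect is moved to the out-side of `p`, where it does no harm because `p` will use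
  -- color 2.
  sourceParity : Semi n → Bool
  sourceParity x = active D x xor (total (active D) ∧ unit (inj₁ p) x)

  source-join : TJoin D sourceParity
  source-join = join-linked (inj₁ p) (active D) (λ x e → linked-source D semicomplete inp x (active⇒nonzero D x e))

  sourceParity-true : ∀ x → vertex x ≢ p → sourceParity x ≡ true
  sourceParity-true x x≢p = cong₂ _xor_ (active-nonzero D x (≢source-active x x≢p))
    (trans (cong (total (active D) ∧_) (unit-≢ {x = inj₁ p} {x} (λ p≡x → x≢p (cong vertex (sym p≡x))))) (∧-zeroʳ _))

  -- p uses color 2, on a single arc outside the join; all other vertices use color 0.
  omitted-arc⇒3-coloring : (J : TJoin D sourceParity) → ∀ q → arc D p q ≡ true → join J p q ≡ false →
    HasWeakOddColoring D 3
  omitted-arc⇒3-coloring J q pq ¬Jpq = (λ u w _ → c u w) , wo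
    where
    c = joinColoring J (λ u w → if δ p u ∧ δ q w then fsuc (fzero {0}) else fzero)
    wo : IsWeakOddColoring D (λ u w _ → c u w)
    wo v with v ≟ p
    ... | yes refl = colorClass-WO {D = D} c v (fsuc (fsuc fzero)) λ where
      (inj₁ .v) refl _   → trans (joinColoring-two J pq ¬Jpq (inj₁ v)) (trans (xor-identityʳ _) (δ-refl v))
      (inj₂ .v) refl d≢0 → contradiction inp d≢0
    ... | no v≢p = colorClass-WO {D = D} c v fzero λ { x refl _ → trans (joinColoring-zero J _ x) (sourceParity-true x v≢p) }

  -- The source needs an arc outside the join for its own color. If the join contains all arcs at
  -- `p`, switching along a 4-cycle through a fork frees one of them and preserves all parities.
  join⇒3-coloring : TJoin D sourceParity → HasWeakOddColoring D 3
  join⇒3-coloring J with any? (λ q → (arc D p q ≟ᵇ true) ×-dec (join J p q ≟ᵇ false))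
  ... | yes (q , pq , ¬Jpq) = omitted-arc⇒3-coloring J q pq ¬Jpq
  ... | no none with fork
  ... | u , v , w , u≢p , v≢w , uv , uw = omitted-arc⇒3-coloring J′ v pv ¬J′pv
    where
    pv = arc-from-source D semicomplete inp (arc⇒≢source uv)
    pw = arc-from-source D semicomplete inp (arc⇒≢source uw)
    cycle : TJoin D (λ _ → false)
    cycle = join-cong
      (λ x → cancel (unit (inj₁ p) x) (unit (inj₁ u) x) (unit (inj₂ v) x) (unit (inj₂ w) x))
      (join-⊕ (join-⊕ (join-arc pv) (join-arc uv)) (join-⊕ (join-arc pw) (join-arc uw)))
      where
      cancel : ∀ a b c d → ((a xor c) xor (b xor c)) xor ((a xor d) xor (b xor d)) ≡ false
      cancel = solve 4 (λ a b c d → ((a :+ c) :+ (b :+ c)) :+ ((a :+ d) :+ (b :+ d)) := con false) refl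
        where open xor-∧-Solver
    -- The 4-cycle p v u w switches exactly two arcs at p, both of which lie in J.
    J′ : TJoin D sourceParity
    J′ = join-cong (λ x → xor-identityʳ _) (join-⊕ J cycle)
    cycle-pv : join cycle p v ≡ true
    cycle-pv = cong₂ _xor_
      (cong₂ _xor_ (cong₂ _∧_ (δ-refl p) (δ-refl v)) (cong (_∧ δ v v) (δ-≢ u≢p)))
      (cong₂ _xor_ (trans (cong (δ p p ∧_) (δ-≢ (≢-sym v≢w))) (∧-zeroʳ (δ p p))) (cong (_∧ δ w v) (δ-≢ u≢p)))
    ¬J′pv : join J′ p v ≡ false
    ¬J′pv = cong₂ _xor_ (¬-not (λ e → none (v , pv , e))) cycle-pv

  source⇒3-coloring : HasWeakOddColoring D 3
  source⇒3-coloring = join⇒3-coloring source-join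

  -- Whichever color each vertex uses, the class `K` of color 0 has equal degree parities at the two
  -- sides of every vertex other than `p`, and odd degree at the out-side of `p`. Its degree sum is
  -- then odd, against the handshake argument.
  source⇒¬2-coloring : ¬ HasWeakOddColoring D 2
  source⇒¬2-coloring (φ , wo) = contradiction (total-boundary K) (true≢false (begin
    total (boundary K)                                              ≡⟨ ∑-distrib-+ (boundary K ∘ inj₁) (boundary K ∘ inj₂) ⟨
    sum (λ v → boundary K (inj₁ v) xor boundary K (inj₂ v))         ≡⟨ sum-cong-≗ parity ⟩
    sum (δ p)                                                       ≡⟨ sum-δ-row p ⟩
    true                                                            ∎))
    where
    open ≡-Reasoning
    K L : Fin n → Fin n → Bool
    K u w = colIs (arc D u w) (φ u w) fzero
    L u w = colIs (arc D u w) (φ u w) (fsuc fzero)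
    complement : ∀ b (f : T b → Fin 2) → colIs b f fzero ≡ b xor colIs b f (fsuc fzero)
    complement false f = refl
    complement true  f with f tt
    ... | fzero      = refl
    ... | fsuc fzero = refl
    boundary-K : ∀ x → boundary K x ≡ odd (semideg D x) xor boundary L x
    boundary-K x = trans (boundary-cong (λ u w → complement (arc D u w) (φ u w)) x)
      (trans (boundary-⊕ (arc D) L x) (cong (_xor boundary L x) (sym (odd-semideg D x))))
    Odd⇒sum : ∀ q → Odd (count n q) → sum q ≡ true
    Odd⇒sum q o = trans (sym (odd-count n q)) (Odd⇒odd (count n q) o)
    in-p : boundary K (inj₂ p) ≡ false
    in-p = trans (sum-cong-≗ (λ w → no-color (arc D w p) (φ w p) (¬-not (λ wp → arc⇒indeg D wp inp)))) (sum-replicate-zero n)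
      where
      no-color : ∀ b (f : T b → Fin 2) → b ≡ false → colIs b f fzero ≡ false
      no-color false f _ = refl
    parity : ∀ v → boundary K (inj₁ v) xor boundary K (inj₂ v) ≡ δ p v
    parity v with p ≟ v | wo v
    parity v | yes refl | inj₁ (o , _) = contradiction o source-outdeg
    parity v | yes refl | inj₂ (fzero , o , _) rewrite in-p = trans (xor-identityʳ _) (Odd⇒sum (K v) (o source-outdeg))
    -- If `p` uses color 1, color 0 is odd there as well, because the out-degree of `p` is even.
    parity v | yes refl | inj₂ (fsuc fzero , o , _) rewrite in-p = trans (xor-identityʳ _)
      (trans (boundary-K (inj₁ v)) (cong₂ _xor_ source-outdeg-even (Odd⇒sum (L v) (o source-outdeg))))
    parity v | no p≢v | inj₁ (o , _) = contradiction o (nonperipheral v (≢-sym p≢v))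
    parity v | no p≢v | inj₂ (fzero , o , i) = cong₂ _xor_
      (Odd⇒sum (K v) (o (≢source-active (inj₁ v) (≢-sym p≢v))))
      (Odd⇒sum (λ w → K w v) (i (≢source-active (inj₂ v) (≢-sym p≢v))))
    -- If `v` uses color 1, each side has color-0 degree of parity opposite to its semi-degree; the
    -- sum of the two has the parity of the degree of `v`.
    parity v | no p≢v | inj₂ (fsuc fzero , o , i) = begin
      boundary K (inj₁ v) xor boundary K (inj₂ v)
        ≡⟨ cong₂ _xor_ (boundary-K (inj₁ v)) (boundary-K (inj₂ v)) ⟩
      (odd (outdeg D v) xor boundary L (inj₁ v)) xor (odd (indeg D v) xor boundary L (inj₂ v))
        ≡⟨ cong₂ (λ a b → (odd (outdeg D v) xor a) xor (odd (indeg D v) xor b))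
             (Odd⇒sum (L v) (o (≢source-active (inj₁ v) (≢-sym p≢v))))
             (Odd⇒sum (λ w → L w v) (i (≢source-active (inj₂ v) (≢-sym p≢v)))) ⟩
      (odd (outdeg D v) xor true) xor (odd (indeg D v) xor true)
        ≡⟨ solve 2 (λ a b → (a :+ con true) :+ (b :+ con true) := a :+ b) refl (odd (outdeg D v)) (odd (indeg D v)) ⟩
      odd (outdeg D v) xor odd (indeg D v)
        ≡⟨ odd-+ (outdeg D v) (indeg D v) ⟨
      odd (deg D v)
        ≡⟨ Even⇒odd (deg D v) (even v) ⟩
      false ∎
      where open xor-∧-Solver using (solve; _:=_; _:+_; con)

-- Invariance under reversal, at most one color, and the cases of the theorem.

reverse-semicomplete : ∀ {n} (D : Digraph n) → Semicomplete D → Semicomplete (reverse D)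
reverse-semicomplete D semicomplete u v u≢v = subst T (∨-comm (arc D u v) (arc D v u)) (semicomplete u v u≢v)

reverse-even : ∀ {n} (D : Digraph n) → EvenDigraph D → EvenDigraph (reverse D)
reverse-even D even v = subst Even (+-comm (outdeg D v) (indeg D v)) (even v)

reverse-onePeripheral : ∀ {n} (D : Digraph n) → ExactlyOnePeripheral D → ExactlyOnePeripheral (reverse D)
reverse-onePeripheral D (p , periph , unique) = p , swap periph , λ w → unique w ∘ swap

¬0-coloring : ∀ {n} (D : Digraph n) → Semicomplete D → n ≥ 2 → ¬ HasWeakOddColoring D 0
¬0-coloring D semicomplete (s≤s (s≤s _)) (φ , _) with adjacent D semicomplete {fzero} {fsuc fzero} (λ ())
... | inj₁ uv = case φ _ _ (Equivalence.from T-≡ uv) of λ ()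
... | inj₂ vu = case φ _ _ (Equivalence.from T-≡ vu) of λ ()

-- With a single color the color class is the whole arc set, so (WO) speaks of the semi-degrees
-- themselves.
colIs-only : ∀ b (f : T b → Fin 1) → colIs b f fzero ≡ b
colIs-only false f = refl
colIs-only true  f with f tt
... | fzero = refl

1-coloring⇒allOddOrZero : ∀ {n} (D : Digraph n) → HasWeakOddColoring D 1 → AllSemiDegreesOddOrZero D
1-coloring⇒allOddOrZero {n} D (φ , wo) v with wo v
... | inj₁ (o , i) = inj₂ o , inj₂ i
... | inj₂ (fzero , o , i) =
  odd-or-zero (λ w → colIs-only (arc D v w) (φ v w)) o , odd-or-zero (λ w → colIs-only (arc D w v) (φ w v)) i
  where
  odd-or-zero : ∀ {p q : Fin n → Bool} → p ≗ q → (count n q ≢ 0 → Odd (count n p)) → Odd (count n q) ⊎ count n q ≡ 0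
  odd-or-zero {p} {q} e h with count n q ≟ℕ 0
  ... | yes z = inj₂ z
  ... | no nz = inj₁ (subst Odd (count-cong n e) (h nz))

allOddOrZero⇒1-coloring : ∀ {n} (D : Digraph n) → AllSemiDegreesOddOrZero D → HasWeakOddColoring D 1
allOddOrZero⇒1-coloring {n} D h = (λ _ _ _ → fzero) , λ v → inj₂ (fzero ,
  odd-count-of (λ w → colIs-only (arc D v w) (λ _ → fzero)) (proj₁ (h v)) ,
  odd-count-of (λ w → colIs-only (arc D w v) (λ _ → fzero)) (proj₂ (h v)))
  where
  odd-count-of : ∀ {p q : Fin n → Bool} → p ≗ q → Odd (count n q) ⊎ count n q ≡ 0 → count n q ≢ 0 → Odd (count n p)
  odd-count-of e (inj₁ o) _  = subst Odd (sym (count-cong n e)) o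
  odd-count-of e (inj₂ z) nz = contradiction z nz

K₁-index : (D : Digraph 1) → WeakOddIndexIs D 0
K₁-index D = (no-arc , λ { fzero → inj₁ (isolated , isolated) }) , λ _ ()
  where
  no-arc : ArcColoring D 0
  no-arc fzero fzero a = ⊥-elim (subst T (loopless D fzero) a)
  isolated : outdeg D fzero ≡ 0
  isolated rewrite loopless D fzero = refl

-- The peripheral vertex is a source or a sink, and reversal reduces the second case to the first.
peripheral-elim : ∀ {n} (P : Digraph n → Set) → (∀ {D} → P (reverse D) → P D) →
  (∀ D p → Semicomplete D → EvenDigraph D → ExactlyOnePeripheral D → indeg D p ≡ 0 → P D) →
  ∀ D → Semicomplete D → EvenDigraph D → ExactlyOnePeripheral D → P D
peripheral-elim P rev src D semicomplete even one@(p , inj₂ inp , _)  = src D p semicomplete even one inp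
peripheral-elim P rev src D semicomplete even one@(p , inj₁ outp , _) =
  rev (src (reverse D) p (reverse-semicomplete D semicomplete) (reverse-even D even) (reverse-onePeripheral D one) outp)

-- The upper bound and the exclusion of two colors and of one color are proved together, so that one
-- reversal argument serves all three.
onePeripheral-index : ∀ {n} → n ≥ 2 → ∀ (D : Digraph n) → Semicomplete D → EvenDigraph D → ExactlyOnePeripheral D →
  HasWeakOddColoring D 3 × ¬ HasWeakOddColoring D 2 × ¬ AllSemiDegreesOddOrZero D
onePeripheral-index {n} n≥2 = peripheral-elim P
  (λ {D} (c₃ , ¬c₂ , ¬odd) → reverse-coloring {D = D} c₃ , ¬c₂ ∘ reverse-coloring {D = reverse D} , λ odd → ¬odd (λ v → proj₂ (odd v) , proj₁ (odd v)))
  source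
  where
  P : Digraph n → Set
  P D = HasWeakOddColoring D 3 × ¬ HasWeakOddColoring D 2 × ¬ AllSemiDegreesOddOrZero D
  source : ∀ D p → Semicomplete D → EvenDigraph D → ExactlyOnePeripheral D → indeg D p ≡ 0 → P D
  source D p semicomplete even (_ , _ , unique) inp =
    source⇒3-coloring D semicomplete n≥2 inp even nonperipheral ,
    source⇒¬2-coloring D semicomplete n≥2 inp even nonperipheral ,
    -- The out-degree of the source is its whole degree, hence even, and it is nonzero.
    λ allOdd → case proj₁ (allOdd p) of λ where
      (inj₁ o) → true≢false (Odd⇒odd (outdeg D p) o) (source-outdeg-even D semicomplete n≥2 inp even nonperipheral)
      (inj₂ z) → source-outdeg D semicomplete n≥2 inp even nonperipheral z
    where
    nonperipheral : ∀ v → v ≢ p → outdeg D v ≢ 0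
    nonperipheral v v≢p z = v≢p (trans (unique v (inj₁ z)) (sym (unique p (inj₂ inp))))

-- A sink is treated as a source of the reversed digraph. Without sources and sinks all sides are
-- nonempty, and the failure of the one-color condition yields an even one.
2-coloring : ∀ {n} → n ≥ 2 → ∀ (D : Digraph n) → Semicomplete D → ¬ AllSemiDegreesOddOrZero D →
  ¬ (EvenDigraph D × ExactlyOnePeripheral D) → HasWeakOddColoring D 2
2-coloring n≥2 D semicomplete ¬allOdd ¬exceptional
  with any? (λ p → indeg D p ≟ℕ 0) | any? (λ p → outdeg D p ≟ℕ 0)
... | yes (p , inp) | _ = source⇒2-coloring D semicomplete n≥2 inp ¬exceptional
... | no _ | yes (p , outp) = reverse-coloring {D = D} (source⇒2-coloring (reverse D) (reverse-semicomplete D semicomplete) n≥2 outp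
  (λ (even , one) → ¬exceptional (reverse-even (reverse D) even , reverse-onePeripheral (reverse D) one)))
... | no ¬source | no ¬sink = nonperipheral⇒2-coloring {D = D} semicomplete
  (λ { (inj₁ v) z → ¬sink (v , z) ; (inj₂ v) z → ¬source (v , z) }) ¬allOdd

theorem3p1 : ∀ (n : ℕ) → 1 ≤ n → (D : Digraph n) → Semicomplete D →
    (n ≡ 1 → WeakOddIndexIs D 0)
    × (n ≥ 2 → AllSemiDegreesOddOrZero D → WeakOddIndexIs D 1)
    × (n ≥ 2 → EvenDigraph D → ExactlyOnePeripheral D → WeakOddIndexIs D 3)
    × (n ≥ 2 → ¬ AllSemiDegreesOddOrZero D
    → ¬ (EvenDigraph D × ExactlyOnePeripheral D) → WeakOddIndexIs D 2)
theorem3p1 n _ D semicomplete =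
    (λ { refl → K₁-index D })
  , (λ n≥2 allOdd → allOddOrZero⇒1-coloring D allOdd , λ where
      zero _ → ¬0-coloring D semicomplete n≥2
      (suc _) (s≤s ()))
  , (λ n≥2 even one →
      let c₃ , ¬c₂ , ¬allOdd = onePeripheral-index n≥2 D semicomplete even one in c₃ , λ where
        zero _ → ¬0-coloring D semicomplete n≥2
        (suc zero) _ → ¬allOdd ∘ 1-coloring⇒allOddOrZero D
        (suc (suc zero)) _ → ¬c₂
        (suc (suc (suc _))) (s≤s (s≤s (s≤s ()))))
  , (λ n≥2 ¬allOdd ¬exceptional → 2-coloring n≥2 D semicomplete ¬allOdd ¬exceptional , λ where
      zero _ → ¬0-coloring D semicomplete n≥2
      (suc zero) _ → ¬allOdd ∘ 1-coloring⇒allOddOrZero D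
      (suc (suc _)) (s≤s (s≤s ())))
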